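{- Let $\|\cdot\|$ be an arbitrary seminorm on $\mathbb{R}^n$, let $\gamma>0$ and $\alpha\ge1$ be constants, and let $A$ be a deterministic or randomized online algorithm. Then there is a class $\mathfrak{C}$ containing two cost functions such that either $R_0(A)=\Omega(T)$, or, for all sufficiently large $T$, both $CR^\alpha_0(A)\ge\gamma$ and $CD^\alpha_0(A)\ge\gamma T$.
   Context: Smoothed online convex optimization (SOCO): a convex decision space $F\subseteq(\mathbb{R}^+)^n$ and a seminorm $\|\cdot\|$ on $\mathbb{R}^n$ are fixed. An online (possibly randomized) algorithm $A$ faces a sequence of cost functions $c^1,c^2,\dots$ with $c^t:F\to\mathbb{R}^+$, and produces decisions $x^1,x^2,\dots\in F$, where $x^s$ may depend only on $c^1,\dots,c^{s-1}$ and on the algorithm's internal randomness. For $\alpha\ge 0$ and lookahead $i\in\mathbb{N}$, the $\alpha$-penalized cost with lookahead $i$ over horizon $T$ is $C_i^\alpha(A)=\mathbb{E}\big[\sum_{t=1}^T c^t(x^{t+i})+\alpha\|x^{t+i}-x^{t+i-1}\|\big]$, with initial action $x^i=0$ and expectation over the algorithm's randomness; write $C_i=C_i^1$. The static optimum is $OPT_s=\min_{x\in F}\sum_{t=1}^T c^t(x)$, and for $\alpha\ge1$ the $\alpha$-unfair dynamic optimum is $OPT_d^\alpha=\min_{(x^1,\dots,x^T)\in F^T}\sum_{t=1}^T c^t(x^t)+\alpha\|x^t-x^{t-1}\|$ (with $x^0=0$). For a class $\mathfrak{C}$ of cost functions: the regret $R_i(A)$ is (at most) $\rho(T)$ if for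 every sequence $(c^1,\dots,c^T)\in\mathfrak{C}^T$, $C_i^0(A)-OPT_s\le\rho(T)$; the $\alpha$-unfair competitive ratio $CR_i^\alpha(A)$ is $\rho(T)$ if for every such sequence $C_i(A)\le\rho(T)\,OPT_d^\alpha+O(1)$; the $\alpha$-unfair competitive difference $CD_i^\alpha(A)$ is $\rho(T)$ if for every such sequence $C_i(A)-OPT_d^\alpha\le\rho(T)$. Statements such as $R_0(A)=\Omega(T)$ or $CR_0^\alpha(A)\ge\gamma$ refer to the best (smallest) $\rho(T)$ for which the corresponding guarantee holds over all sequences from $\mathfrak{C}$.
   Formalization: The decision space F is assumed to contain at least two distinct points; for a single-point F the claim is false, since every algorithm has zero regret and competitive difference at most 0. -}

module Defs where

open import Algebra.Structures using (IsCommutativeRing)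
import Algebra.Construct.NaturalChoice.Max as Maximum
open import Axiom.ExcludedMiddle using (ExcludedMiddle)
open import Data.Bool using (if_then_else_)
open import Data.Fin using (Fin)
open import Data.List as List using (List; []; _∷_; _∷ʳ_)
open import Data.List.Relation.Unary.All as ListAll using ()
open import Data.Nat as ℕ using (ℕ; zero; suc)
open import Data.Product using (Σ; ∃; ∃₂; _×_; _,_; proj₁; proj₂)
open import Data.Vec as Vec using (Vec; []; _∷_; lookup; zipWith; replicate)
open import Data.Vec.Relation.Unary.All using (All)
open import Function using (_⇔_)
open import Level using (0ℓ) renaming (suc to lsuc)
open import Relation.Binary using (IsTotalOrder; TotalOrder)
open import Relation.Binary.PropositionalEquality using (_≡_; _≢_; subst)
open import Relation.Nullary using (does; ¬_)
open import Relation.Unary using (Pred; U; ∁; ⋃; _≐_; _∈_; _⊢_)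

module _ {X : Set} (_≤_ : X → X → Set) {I : Set} where

  IsInfimum IsSupremum : (I → X) → X → Set
  IsInfimum  f m = (∀ i → m ≤ f i) × (∀ b → (∀ i → b ≤ f i) → b ≤ m)
  IsSupremum f m = (∀ i → f i ≤ m) × (∀ b → (∀ i → f i ≤ b) → m ≤ b)

-- A Dedekind-complete ordered field.  Any two are isomorphic, so a theorem
-- about all of them is a theorem about the real numbers.
record RealNumbers : Set₁ where
  infix  4 _≤_ _<_
  infixl 6 _+_ _-_
  infixl 7 _*_
  infix  8 -_
  field
    ℝ     : Set
    _≤_   : ℝ → ℝ → Set
    _+_   : ℝ → ℝ → ℝ
    _*_   : ℝ → ℝ → ℝ
    -_    : ℝ → ℝ
    0ℝ    : ℝ
    1ℝ    : ℝ
    isCommutativeRing : IsCommutativeRing _≡_ _+_ _*_ -_ 0ℝ 1ℝ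
    isTotalOrder      : IsTotalOrder _≡_ _≤_
    0≤1        : 0ℝ ≤ 1ℝ
    0≢1        : 0ℝ ≢ 1ℝ
    inverse    : ∀ x → x ≢ 0ℝ → ∃ λ y → x * y ≡ 1ℝ
    +-monoˡ-≤  : ∀ z {x y} → x ≤ y → x + z ≤ y + z
    *-nonneg   : ∀ {x y} → 0ℝ ≤ x → 0ℝ ≤ y → 0ℝ ≤ x * y

    complete   : {I : Set} (f : I → ℝ) → I → ∀ b → (∀ i → b ≤ f i) →
                 ∃ (IsInfimum _≤_ f)

  open IsCommutativeRing isCommutativeRing public
    using (+-identityˡ)
  open IsTotalOrder isTotalOrder public
    using () renaming (trans to ≤-trans; reflexive to ≤-reflexive)

  totalOrder : TotalOrder 0ℓ 0ℓ 0ℓ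
  totalOrder = record { isTotalOrder = isTotalOrder }

  open Maximum totalOrder public using (_⊔_)

  _<_ : ℝ → ℝ → Set
  x < y = x ≤ y × x ≢ y

  _-_ : ℝ → ℝ → ℝ
  x - y = x + - y

  ∣_∣ : ℝ → ℝ
  ∣ x ∣ = x ⊔ - x

  fromℕ : ℕ → ℝ
  fromℕ zero    = 0ℝ
  fromℕ (suc k) = 1ℝ + fromℕ k

  partialSum : (ℕ → ℝ) → ℕ → ℝ
  partialSum a zero    = 0ℝ
  partialSum a (suc k) = partialSum a k + a k

  +-nonneg : ∀ {x y} → 0ℝ ≤ x → 0ℝ ≤ y → 0ℝ ≤ x + y
  +-nonneg {x} {y} 0≤x 0≤y =
    ≤-trans 0≤y (subst (_≤ x + y) (+-identityˡ y) (+-monoˡ-≤ y 0≤x))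

  inf : {I : Set} (f : I → ℝ) → I → (∀ i → 0ℝ ≤ f i) → ℝ
  inf f i 0≤f = proj₁ (complete f i 0ℝ 0≤f)

-- Subsets are predicates; excluded middle is what makes them agree with
-- subsets in the classical sense (and makes indicator functions available).
module SOCO (em : ExcludedMiddle 0ℓ) (ℛ : RealNumbers) where

  open RealNumbers ℛ public

  Point : ℕ → Set
  Point n = Vec ℝ n

  infixl 6 _⊕_ _⊖_
  infixr 7 _•_

  _⊕_ _⊖_ : ∀ {n} → Point n → Point n → Point n
  _⊕_ = zipWith _+_
  _⊖_ = zipWith _-_

  _•_ : ∀ {n} → ℝ → Point n → Point n
  a • x = Vec.map (a *_) x

  origin : ∀ {n} → Point n
  origin {n} = replicate n 0ℝ

  record Seminorm (n : ℕ) : Set where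
    field
      ‖_‖         : Point n → ℝ
      nonneg      : ∀ x → 0ℝ ≤ ‖ x ‖
      homogeneous : ∀ a x → ‖ a • x ‖ ≡ ∣ a ∣ * ‖ x ‖
      triangle    : ∀ x y → ‖ x ⊕ y ‖ ≤ ‖ x ‖ + ‖ y ‖

  record IsσAlgebra {X : Set} (𝓕 : Pred X 0ℓ → Set₁) : Set₁ where
    field
      resp-≐     : ∀ {A B} → A ≐ B → 𝓕 A → 𝓕 B
      whole      : 𝓕 U
      complement : ∀ {A} → 𝓕 A → 𝓕 (∁ A)
      union      : (A : ℕ → Pred X 0ℓ) → (∀ k → 𝓕 (A k)) → 𝓕 (⋃ ℕ A)

  data Borel {n : ℕ} : Pred (Point n) 0ℓ → Set₁ where
    halfspace-≤ : ∀ i a → Borel (λ x → lookup x i ≤ a)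
    halfspace-≥ : ∀ i a → Borel (λ x → a ≤ lookup x i)
    resp-≐      : ∀ {A B} → A ≐ B → Borel A → Borel B
    whole       : Borel U
    complement  : ∀ {A} → Borel A → Borel (∁ A)
    union       : (A : ℕ → Pred (Point n) 0ℓ) → (∀ k → Borel (A k)) →
                  Borel (⋃ ℕ A)

  record ProbabilitySpace : Set₂ where
    field
      Ω          : Set
      Event      : Pred Ω 0ℓ → Set₁
      isσAlgebra : IsσAlgebra Event
      -- Only the values on events matter.
      ℙ          : Pred Ω 0ℓ → ℝ
      ℙ-cong     : ∀ {A B} → Event A → Event B → A ≐ B → ℙ A ≡ ℙ B
      ℙ-nonneg   : ∀ {A} → Event A → 0ℝ ≤ ℙ A
      ℙ-whole    : ℙ U ≡ 1ℝ

      ℙ-additive : (A : ℕ → Pred Ω 0ℓ) → (∀ k → Event (A k)) →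
                   (∀ j k ω → j ≢ k → ¬ (A j ω × A k ω)) →
                   IsSupremum _≤_ (partialSum (λ k → ℙ (A k))) (ℙ (⋃ ℕ A))

    indicator : Pred Ω 0ℓ → Ω → ℝ
    indicator A ω = if does (em {A ω}) then 1ℝ else 0ℝ

    -- The nonnegative simple function Σⱼ aⱼ 1_{Aⱼ}; the Aⱼ may overlap.
    record Simple : Set₁ where
      field
        terms        : List (ℝ × Pred Ω 0ℓ)
        coeff-nonneg : ListAll.All (λ aA → 0ℝ ≤ proj₁ aA) terms
        measurable   : ListAll.All (λ aA → Event (proj₂ aA)) terms

      value : Ω → ℝ
      value ω = List.foldr (λ (a , A) v → a * indicator A ω + v) 0ℝ terms

      integral : ℝ
      integral = List.foldr (λ (a , A) v → a * ℙ A + v) 0ℝ terms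

    -- The expectation (Lebesgue integral) of a nonnegative X is the supremum
    -- in [0,∞] of the integrals of the simple functions below X.  As it may be
    -- infinite, it is given by its real upper bounds.
    infix 4 𝔼[_]≤_
    𝔼[_]≤_ : (Ω → ℝ) → ℝ → Set₁
    𝔼[ X ]≤ r = ∀ (s : Simple) → (∀ ω → Simple.value s ω ≤ X ω) →
                Simple.integral s ≤ r

  record DecisionSpace (n : ℕ) : Set₁ where
    field
      Feasible  : Pred (Point n) 0ℓ
      positive  : ∀ {x} → Feasible x → ∀ i → 0ℝ ≤ lookup x i
      convex    : ∀ {x y} t → 0ℝ ≤ t → t ≤ 1ℝ → Feasible x → Feasible y →
                  Feasible (t • x ⊕ (1ℝ - t) • y)
      inhabited : ∃ Feasible

  -- If F is a single point then every algorithm is optimal.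
  Nontrivial : ∀ {n} → DecisionSpace n → Set
  Nontrivial F = ∃₂ λ x y → Feasible x × Feasible y × x ≢ y
    where open DecisionSpace F

  module _ {n : ℕ} (F : DecisionSpace n) where
    open DecisionSpace F

    -- A cost is a convex function F → ℝ⁺, represented by a function on all of ℝⁿ whose
    -- values outside F play no role.  Borel measurability on F gives the
    -- expected costs of a randomized algorithm their meaning.
    record Cost : Set₁ where
      field
        cost       : Point n → ℝ
        nonneg     : ∀ {x} → Feasible x → 0ℝ ≤ cost x
        convexCost : ∀ {x y} t → 0ℝ ≤ t → t ≤ 1ℝ → Feasible x → Feasible y →
                     cost (t • x ⊕ (1ℝ - t) • y) ≤ t * cost x + (1ℝ - t) * cost y
        measurable : ∀ a → ∃ λ B → Borel B ×
                     (∀ {x} → Feasible x → cost x ≤ a ⇔ B x)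

    open Cost public using (cost)

    -- The decision in a round depends on the costs of the preceding rounds
    -- (oldest first) and on ω.  Deterministic algorithms are those for which Ω
    -- is a point.
    record Algorithm : Set₂ where
      field
        space : ProbabilitySpace
      open ProbabilitySpace space public
      field
        decide     : List Cost → Ω → Point n
        feasible   : ∀ h ω → Feasible (decide h ω)
        measurable : ∀ h {B} → Borel B → Event (decide h ⊢ B)

      playAfter : List Cost → ∀ {T} → Vec Cost T → Ω → Vec (Point n) T
      playAfter h []       ω = []
      playAfter h (c ∷ cs) ω = decide h ω ∷ playAfter (h ∷ʳ c) cs ω

      play : ∀ {T} → Vec Cost T → Ω → Vec (Point n) T
      play = playAfter []

  Distinct : ∀ {n} {F : DecisionSpace n} → Cost F → Cost F → Set
  Distinct {F = F} f g =
    ∃ λ x → DecisionSpace.Feasible F x × cost f x ≢ cost g x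

  module _ {n : ℕ} {F : DecisionSpace n} where
    open DecisionSpace F

    staticCost : ∀ {T} → Vec (Cost F) T → Point n → ℝ
    staticCost []       x = 0ℝ
    staticCost (c ∷ cs) x = cost c x + staticCost cs x

    staticCost-nonneg : ∀ {T} (cs : Vec (Cost F) T) {x} → Feasible x →
                        0ℝ ≤ staticCost cs x
    staticCost-nonneg []       x∈F = ≤-reflexive _≡_.refl
    staticCost-nonneg (c ∷ cs) x∈F =
      +-nonneg (Cost.nonneg c x∈F) (staticCost-nonneg cs x∈F)

    OPTₛ : ∀ {T} → Vec (Cost F) T → ℝ
    OPTₛ cs = inf {I = ∃ Feasible} (λ (x , _) → staticCost cs x) inhabited
                  (λ (_ , x∈F) → staticCost-nonneg cs x∈F)

    module _ (ν : Seminorm n) where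
      open Seminorm ν

      penalizedCostFrom : ℝ → Point n → ∀ {T} →
                          Vec (Cost F) T → Vec (Point n) T → ℝ
      penalizedCostFrom α x₀ []       []       = 0ℝ
      penalizedCostFrom α x₀ (c ∷ cs) (x ∷ xs) =
        (cost c x + α * ‖ x ⊖ x₀ ‖) + penalizedCostFrom α x cs xs

      penalizedCost : ℝ → ∀ {T} → Vec (Cost F) T → Vec (Point n) T → ℝ
      penalizedCost α = penalizedCostFrom α origin

      penalizedCostFrom-nonneg :
        ∀ {α} → 0ℝ ≤ α → ∀ x₀ {T} (cs : Vec (Cost F) T) (xs : Vec (∃ Feasible) T) →
        0ℝ ≤ penalizedCostFrom α x₀ cs (Vec.map proj₁ xs)
      penalizedCostFrom-nonneg 0≤α x₀ []       []               = ≤-reflexive _≡_.refl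
      penalizedCostFrom-nonneg 0≤α x₀ (c ∷ cs) ((x , x∈F) ∷ xs) =
        +-nonneg (+-nonneg (Cost.nonneg c x∈F) (*-nonneg 0≤α (nonneg (x ⊖ x₀))))
                 (penalizedCostFrom-nonneg 0≤α x cs xs)

      OPT_d : (α : ℝ) → 1ℝ ≤ α → ∀ {T} → Vec (Cost F) T → ℝ
      OPT_d α 1≤α {T} cs =
        inf {I = Vec (∃ Feasible) T}
            (λ xs → penalizedCost α cs (Vec.map proj₁ xs))
            (replicate T inhabited)
            (penalizedCostFrom-nonneg (≤-trans 0≤1 1≤α) origin cs)

      module _ (A : Algorithm F) where
        open Algorithm A using (𝔼[_]≤_; play)

        -- C₀^α(A) ≤ r
        ExpectedCost≤ : ℝ → ∀ {T} → Vec (Cost F) T → ℝ → Set₁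
        ExpectedCost≤ α cs r = 𝔼[ (λ ω → penalizedCost α cs (play cs ω)) ]≤ r

        -- In the following three predicates ρ is a guarantee for the horizon T
        -- alone.  Since C₀ may be infinite, C₀ − OPT ≤ ρ is written
        -- C₀ ≤ OPT + ρ.
        module _ (𝕮 : Pred (Cost F) (lsuc 0ℓ)) (T : ℕ) where

          Regret≤ : ℝ → Set₁
          Regret≤ ρ = (cs : Vec (Cost F) T) → All 𝕮 cs →
                      ExpectedCost≤ 0ℝ cs (OPTₛ cs + ρ)

          -- K is the constant hidden in the O(1) term.
          CompetitiveRatio≤ : (α : ℝ) → 1ℝ ≤ α → (K : ℝ) → ℝ → Set₁
          CompetitiveRatio≤ α 1≤α K ρ =
            (cs : Vec (Cost F) T) → All 𝕮 cs →
            ExpectedCost≤ 1ℝ cs (ρ * OPT_d α 1≤α cs + K)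

          CompetitiveDifference≤ : (α : ℝ) → 1ℝ ≤ α → ℝ → Set₁
          CompetitiveDifference≤ α 1≤α ρ =
            (cs : Vec (Cost F) T) → All 𝕮 cs →
            ExpectedCost≤ 1ℝ cs (OPT_d α 1≤α cs + ρ)

  -- The smallest ρ satisfying the guarantee G is at least v (it is ∞ if no real
  -- ρ does).
  infix 4 Best_≥_
  Best_≥_ : (ℝ → Set₁) → ℝ → Set₁
  Best G ≥ v = ∀ ρ → G ρ → v ≤ ρ

  Eventually : (ℕ → Set₁) → Set₁
  Eventually P = ∃ λ T₀ → ∀ T → T₀ ℕ.≤ T → P T

  -- The smallest guarantee of the family G is Ω(T).
  BestIsΩ[T] : (ℕ → ℝ → Set₁) → Set₁
  BestIsΩ[T] G = ∃ λ k → 0ℝ < k × Eventually (λ T → Best G T ≥ k * fromℕ T)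

{-# OPTIONS --safe #-}
module Submission where

-- With two costs f and g that vanish at points u and v of F respectively, the
-- dynamic optimum pays only for movement: at most α D per round, where D bounds
-- the norms of the steps between origin, u and v.  A large slope makes one of f
-- and g at least 2q at every point of F, so in each round an adversary that knows
-- the distribution of the next decision can pick the one of them that costs 2q
-- with probability at least 1/2.  The algorithm then pays at least q per round,
-- and any q ≥ γ α D + α D + γ + 1 gives the second alternative of the theorem,
-- whatever the regret is.

open import Defs
open import Axiom.ExcludedMiddle using (ExcludedMiddle)
open import Data.Nat using (ℕ)
open import Data.Product using (_×_; ∃₂)
open import Data.Sum using (_⊎_)
open import Level using (0ℓ)
open import Relation.Unary using (｛_｝; _∪_)

open import Algebra.Bundles using (CommutativeRing)
import Algebra.Construct.NaturalChoice.Max as Maximum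
import Algebra.Properties.CommutativeSemigroup as CommutativeSemigroupProperties
import Algebra.Properties.Ring as RingProperties
open import Data.Empty using (⊥-elim)
open import Data.Fin using (Fin; zero; suc)
open import Data.List using (List; []; _∷_; _∷ʳ_)
open import Data.List.Relation.Unary.All using ([]; _∷_)
open import Data.Nat as ℕ using (zero; suc; z≤n; s≤s)
open import Data.Product using (∃; _,_; proj₁; proj₂)
open import Data.Sum using (inj₁; inj₂)
open import Data.Unit using (tt)
open import Data.Vec as Vec using (Vec; []; _∷_; lookup)
open import Data.Vec.Properties using (lookup-map; lookup-zipWith)
open import Data.Vec.Relation.Unary.All as VecAll using ([]; _∷_)
open import Function using (mk⇔)
open import Level using () renaming (suc to lsuc)
open import Relation.Binary using (TotalOrder)
import Relation.Binary.Reasoning.PartialOrder as PartialOrderReasoning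
open import Relation.Binary.PropositionalEquality
  using (_≡_; _≢_; refl; sym; trans; cong; cong₂; subst; module ≡-Reasoning)
open import Relation.Nullary using (¬_; yes; no)
open import Relation.Nullary.Decidable using (decidable-stable)
open import Relation.Unary using (Pred; U; ∁; ⋃; _⊢_)

-- Ordered-field arithmetic and the Archimedean property.

module OrderedField (ℛ : RealNumbers) where

  open RealNumbers ℛ

  commutativeRing : CommutativeRing 0ℓ 0ℓ
  commutativeRing = record { isCommutativeRing = isCommutativeRing }

  open CommutativeRing commutativeRing public
    using ( +-comm; +-assoc; +-identityʳ; -‿inverseʳ; *-comm; *-assoc
          ; *-identityˡ; *-identityʳ; distribˡ; distribʳ; zeroˡ; zeroʳ; ring)
  open CommutativeSemigroupProperties (CommutativeRing.*-commutativeSemigroup commutativeRing) public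
    using (x∙yz≈y∙xz)
  open CommutativeSemigroupProperties (CommutativeRing.+-commutativeSemigroup commutativeRing) public
    using () renaming (interchange to +-interchange)
  open RingProperties ring public
    using (-‿distribʳ-*; -‿+-comm; x[y-z]≈xy-xz)
    renaming ( //-rightDividesˡ to x-y+y≡x; //-rightDividesʳ to x+y-y≡x; ⁻¹-anti-homo-// to -[x-y]≡y-x)
  open Maximum totalOrder public using (x≤x⊔y; x≤y⊔x; ⊔-lub)
  open TotalOrder totalOrder public
    using (poset; antisym; total) renaming (refl to ≤-refl)
  module ≤-Reasoning = PartialOrderReasoning poset

  +-monoʳ-≤ : ∀ z {x y} → x ≤ y → z + x ≤ z + y
  +-monoʳ-≤ z {x} {y} x≤y = begin
    z + x ≡⟨ +-comm z x ⟩
    x + z ≤⟨ +-monoˡ-≤ z x≤y ⟩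
    y + z ≡⟨ +-comm y z ⟩
    z + y ∎
    where open ≤-Reasoning

  +-mono-≤ : ∀ {w x y z} → w ≤ x → y ≤ z → w + y ≤ x + z
  +-mono-≤ {x = x} {y} w≤x y≤z = ≤-trans (+-monoˡ-≤ y w≤x) (+-monoʳ-≤ x y≤z)

  +-cancelʳ-≤ : ∀ z {x y} → x + z ≤ y + z → x ≤ y
  +-cancelʳ-≤ z {x} {y} x+z≤y+z = begin
    x           ≡⟨ x+y-y≡x z x ⟨
    x + z - z   ≤⟨ +-monoˡ-≤ (- z) x+z≤y+z ⟩
    y + z - z   ≡⟨ x+y-y≡x z y ⟩
    y           ∎
    where open ≤-Reasoning

  +-cancelˡ-≤ : ∀ z {x y} → z + x ≤ z + y → x ≤ y
  +-cancelˡ-≤ z {x} {y} z+x≤z+y = +-cancelʳ-≤ z (begin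
    x + z ≡⟨ +-comm x z ⟩
    z + x ≤⟨ z+x≤z+y ⟩
    z + y ≡⟨ +-comm z y ⟩
    y + z ∎)
    where open ≤-Reasoning

  x+y≤z⇒x≤z-y : ∀ {x y z} → x + y ≤ z → x ≤ z - y
  x+y≤z⇒x≤z-y {x} {y} {z} x+y≤z =
    +-cancelʳ-≤ y (subst (x + y ≤_) (sym (x-y+y≡x y z)) x+y≤z)

  x-y≤z⇒x≤z+y : ∀ {x y z} → x - y ≤ z → x ≤ z + y
  x-y≤z⇒x≤z+y {x} {y} {z} x-y≤z =
    subst (_≤ z + y) (x-y+y≡x y x) (+-monoˡ-≤ y x-y≤z)

  x≤y+z⇒x-z≤y : ∀ {x y z} → x ≤ y + z → x - z ≤ y
  x≤y+z⇒x-z≤y {x} {y} {z} x≤y+z =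
    +-cancelʳ-≤ z (subst (_≤ y + z) (sym (x-y+y≡x z x)) x≤y+z)

  x≤y⇒0≤y-x : ∀ {x y} → x ≤ y → 0ℝ ≤ y - x
  x≤y⇒0≤y-x {x} {y} x≤y = x+y≤z⇒x≤z-y (subst (_≤ y) (sym (+-identityˡ x)) x≤y)

  x≤x+y : ∀ x {y} → 0ℝ ≤ y → x ≤ x + y
  x≤x+y x {y} 0≤y = subst (_≤ x + y) (+-identityʳ x) (+-monoʳ-≤ x 0≤y)

  y≤x+y : ∀ {x} y → 0ℝ ≤ x → y ≤ x + y
  y≤x+y {x} y 0≤x = subst (_≤ x + y) (+-identityˡ y) (+-monoˡ-≤ y 0≤x)

  *-monoˡ-≤ : ∀ {z} → 0ℝ ≤ z → ∀ {x y} → x ≤ y → z * x ≤ z * y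
  *-monoˡ-≤ {z} 0≤z {x} {y} x≤y = begin
    z * x                     ≤⟨ y≤x+y (z * x) (*-nonneg 0≤z (x≤y⇒0≤y-x x≤y)) ⟩
    z * (y - x) + z * x       ≡⟨ distribˡ z (y - x) x ⟨
    z * ((y - x) + x)         ≡⟨ cong (z *_) (x-y+y≡x x y) ⟩
    z * y                     ∎
    where open ≤-Reasoning

  *-monoʳ-≤ : ∀ {z} → 0ℝ ≤ z → ∀ {x y} → x ≤ y → x * z ≤ y * z
  *-monoʳ-≤ {z} 0≤z {x} {y} x≤y = begin
    x * z ≡⟨ *-comm x z ⟩
    z * x ≤⟨ *-monoˡ-≤ 0≤z x≤y ⟩
    z * y ≡⟨ *-comm z y ⟩
    y * z ∎
    where open ≤-Reasoning

  inverse-nonneg : ∀ {x y} → 0ℝ ≤ x → x * y ≡ 1ℝ → 0ℝ ≤ y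
  inverse-nonneg {x} {y} 0≤x xy≡1 with total 0ℝ y
  ... | inj₁ 0≤y = 0≤y
  ... | inj₂ y≤0 = ⊥-elim (0≢1 (antisym 0≤1 (begin
    1ℝ     ≡⟨ xy≡1 ⟨
    x * y  ≤⟨ *-monoˡ-≤ 0≤x y≤0 ⟩
    x * 0ℝ ≡⟨ zeroʳ x ⟩
    0ℝ     ∎)))
    where open ≤-Reasoning

  inverse-of-positive : ∀ {x} → 0ℝ < x → ∃ λ y → 0ℝ ≤ y × x * y ≡ 1ℝ
  inverse-of-positive (0≤x , 0≢x) =
    let y , xy≡1 = inverse _ (λ x≡0 → 0≢x (sym x≡0))
    in y , inverse-nonneg 0≤x xy≡1 , xy≡1

  half-of-positive : ∀ {x} → 0ℝ < x → ∃ λ y → 0ℝ < y × y + y ≡ x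
  half-of-positive {x} (0≤x , 0≢x) =
    let h , 0≤h , 2h≡1 = inverse-of-positive (≤-trans 0≤1 1≤2 , 0≢2)
        xh+xh≡x = begin
          x * h + x * h   ≡⟨ distribˡ x h h ⟨
          x * (h + h)     ≡⟨ cong (λ k → x * (k + k)) (*-identityˡ h) ⟨
          x * (1ℝ * h + 1ℝ * h)  ≡⟨ cong (x *_) (distribʳ h 1ℝ 1ℝ) ⟨
          x * ((1ℝ + 1ℝ) * h)    ≡⟨ cong (x *_) 2h≡1 ⟩
          x * 1ℝ          ≡⟨ *-identityʳ x ⟩
          x               ∎
        0≢xh = λ 0≡xh → 0≢x (trans (sym (+-identityˡ 0ℝ))
                               (trans (cong₂ _+_ 0≡xh 0≡xh) xh+xh≡x))
    in x * h , (*-nonneg 0≤x 0≤h , 0≢xh) , xh+xh≡x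
    where
    open ≡-Reasoning
    1≤2 : 1ℝ ≤ 1ℝ + 1ℝ
    1≤2 = x≤x+y 1ℝ 0≤1
    0≢2 : 0ℝ ≢ 1ℝ + 1ℝ
    0≢2 0≡2 = 0≢1 (antisym 0≤1 (subst (1ℝ ≤_) (sym 0≡2) 1≤2))

  x≤∣x∣ : ∀ x → x ≤ ∣ x ∣
  x≤∣x∣ x = x≤x⊔y x (- x)

  -x≤∣x∣ : ∀ x → - x ≤ ∣ x ∣
  -x≤∣x∣ x = x≤y⊔x x (- x)

  ∣x∣-nonneg : ∀ x → 0ℝ ≤ ∣ x ∣
  ∣x∣-nonneg x with total 0ℝ x
  ... | inj₁ 0≤x = ≤-trans 0≤x (x≤∣x∣ x)
  ... | inj₂ x≤0 = ≤-trans (subst (0ℝ ≤_) (+-identityˡ (- x)) (x≤y⇒0≤y-x x≤0)) (-x≤∣x∣ x)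

  ∣x-x∣≡0 : ∀ x → ∣ x - x ∣ ≡ 0ℝ
  ∣x-x∣≡0 x rewrite -‿inverseʳ x = antisym (⊔-lub ≤-refl -0≤0) (∣x∣-nonneg 0ℝ)
    where
    -0≤0 : - 0ℝ ≤ 0ℝ
    -0≤0 = ≤-reflexive (trans (sym (+-identityˡ (- 0ℝ))) (-‿inverseʳ 0ℝ))

  ≰⇒≥ : ∀ {x y} → ¬ (x ≤ y) → y ≤ x
  ≰⇒≥ {x} {y} x≰y with total x y
  ... | inj₁ x≤y = ⊥-elim (x≰y x≤y)
  ... | inj₂ y≤x = y≤x

  t+[1-t]≡1 : ∀ t → t + (1ℝ - t) ≡ 1ℝ
  t+[1-t]≡1 t = trans (+-comm t (1ℝ - t)) (x-y+y≡x t 1ℝ)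

  convexCombination-sub : ∀ t x y p →
    (t * x + (1ℝ - t) * y) - p ≡ t * (x - p) + (1ℝ - t) * (y - p)
  convexCombination-sub t x y p = begin
    (t * x + s * y) - p                     ≡⟨ cong (λ k → (t * x + s * y) - k) p≡ ⟩
    (t * x + s * y) - (t * p + s * p)       ≡⟨ cong ((t * x + s * y) +_) (-‿+-comm (t * p) (s * p)) ⟨
    (t * x + s * y) + (- (t * p) - s * p)   ≡⟨ +-interchange (t * x) (s * y) (- (t * p)) (- (s * p)) ⟩
    (t * x - t * p) + (s * y - s * p)       ≡⟨ cong₂ _+_ (x[y-z]≈xy-xz t x p) (x[y-z]≈xy-xz s y p) ⟨
    t * (x - p) + s * (y - p)               ∎
    where
    open ≡-Reasoning
    s = 1ℝ - t
    p≡ : p ≡ t * p + s * p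
    p≡ = sym (trans (sym (distribʳ p t s)) (trans (cong (_* p) (t+[1-t]≡1 t)) (*-identityˡ p)))

  -- The absolute value is the larger of two linear functions, so it suffices to bound the
  -- combination and its negative.
  ∣-∣-convex : ∀ t x y → 0ℝ ≤ t → t ≤ 1ℝ →
               ∣ t * x + (1ℝ - t) * y ∣ ≤ t * ∣ x ∣ + (1ℝ - t) * ∣ y ∣
  ∣-∣-convex t x y 0≤t t≤1 = ⊔-lub
    (+-mono-≤ (*-monoˡ-≤ 0≤t (x≤∣x∣ x)) (*-monoˡ-≤ 0≤s (x≤∣x∣ y)))
    (subst (_≤ t * ∣ x ∣ + s * ∣ y ∣) (sym neg)
      (+-mono-≤ (*-monoˡ-≤ 0≤t (-x≤∣x∣ x)) (*-monoˡ-≤ 0≤s (-x≤∣x∣ y))))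
    where
    s = 1ℝ - t
    0≤s : 0ℝ ≤ s
    0≤s = x≤y⇒0≤y-x t≤1
    neg : - (t * x + s * y) ≡ t * - x + s * - y
    neg = trans (sym (-‿+-comm (t * x) (s * y)))
                (cong₂ _+_ (-‿distribʳ-* t x) (-‿distribʳ-* s y))

  fromℕ-nonneg : ∀ k → 0ℝ ≤ fromℕ k
  fromℕ-nonneg zero    = ≤-refl
  fromℕ-nonneg (suc k) = +-nonneg 0≤1 (fromℕ-nonneg k)

  fromℕ-mono-≤ : ∀ {j k} → j ℕ.≤ k → fromℕ j ≤ fromℕ k
  fromℕ-mono-≤ {k = k} z≤n = fromℕ-nonneg k
  fromℕ-mono-≤ (s≤s j≤k)   = +-monoʳ-≤ 1ℝ (fromℕ-mono-≤ j≤k)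

  suc-*-≡ : ∀ k x → fromℕ (suc k) * x ≡ x + fromℕ k * x
  suc-*-≡ k x = trans (distribʳ x 1ℝ (fromℕ k)) (cong (_+ fromℕ k * x) (*-identityˡ x))

  -- Were ℕ bounded above by x, the infimum m of the −k would satisfy m + 1 ≤ m.
  fromℕ-unbounded : ∀ x → ¬ (∀ k → fromℕ k ≤ x)
  fromℕ-unbounded x bounded = 0≢1 (antisym 0≤1 (+-cancelˡ-≤ m (begin
    m + 1ℝ  ≤⟨ greatest (m + 1ℝ) (λ k → x+y≤z⇒x≤z-y (begin
                 m + 1ℝ + fromℕ k      ≡⟨ +-assoc m 1ℝ (fromℕ k) ⟩
                 m + fromℕ (suc k)     ≤⟨ +-monoˡ-≤ (fromℕ (suc k)) (lower (suc k)) ⟩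
                 (0ℝ - fromℕ (suc k)) + fromℕ (suc k) ≡⟨ x-y+y≡x (fromℕ (suc k)) 0ℝ ⟩
                 0ℝ                    ∎)) ⟩
    m       ≡⟨ +-identityʳ m ⟨
    m + 0ℝ  ∎)))
    where
    open ≤-Reasoning
    infimum : ∃ (IsInfimum _≤_ (λ k → 0ℝ - fromℕ k))
    infimum = complete _ 0 (0ℝ - x) λ k → x+y≤z⇒x≤z-y (begin
      (0ℝ - x) + fromℕ k ≤⟨ +-monoʳ-≤ (0ℝ - x) (bounded k) ⟩
      (0ℝ - x) + x       ≡⟨ x-y+y≡x x 0ℝ ⟩
      0ℝ                 ∎)
    m : ℝ
    m = proj₁ infimum
    lower : ∀ k → m ≤ 0ℝ - fromℕ k
    lower = proj₁ (proj₂ infimum)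
    greatest : ∀ b → (∀ k → b ≤ 0ℝ - fromℕ k) → b ≤ m
    greatest = proj₂ (proj₂ infimum)

  -- Supplies the horizon from which `T` beats the additive constant `K` of the competitive ratio;
  -- excluded middle turns unboundedness into a witness.
  archimedean : ExcludedMiddle 0ℓ → ∀ x → ∃ λ k → ¬ (fromℕ k ≤ x)
  archimedean em x = decidable-stable em λ none →
    fromℕ-unbounded x λ k → decidable-stable em λ k≰x → none (k , k≰x)

  inf-lower : ∀ {I : Set} (f : I → ℝ) i 0≤f j → inf f i 0≤f ≤ f j
  inf-lower f i 0≤f = proj₁ (proj₂ (complete f i 0ℝ 0≤f))

  inf-nonneg : ∀ {I : Set} (f : I → ℝ) i 0≤f → 0ℝ ≤ inf f i 0≤f
  inf-nonneg f i 0≤f = proj₂ (proj₂ (complete f i 0ℝ 0≤f)) 0ℝ 0≤f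

-- Borel intersections and probabilities of complements.

module LowerBound (em : ExcludedMiddle 0ℓ) (ℛ : RealNumbers) where

  open SOCO em ℛ
  open OrderedField ℛ

  -- De Morgan, applied to a countable family that repeats `∁ B` from index 1 on.
  Borel-∩ : ∀ {n} {A B : Pred (Point n) 0ℓ} → Borel A → Borel B → Borel (λ x → A x × B x)
  Borel-∩ {n} {A} {B} borelA borelB = resp-≐
    ( (λ x∉∪ → decidable-stable em (λ x∉A → x∉∪ (0 , x∉A))
             , decidable-stable em (λ x∉B → x∉∪ (1 , x∉B)))
    , λ { (x∈A , x∈B) (zero , x∉A) → x∉A x∈A ; (x∈A , x∈B) (suc _ , x∉B) → x∉B x∈B })
    (complement (union complements borel))
    where
    complements : ℕ → Pred (Point n) 0ℓ
    complements zero    = ∁ A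
    complements (suc _) = ∁ B
    borel : ∀ k → Borel (complements k)
    borel zero    = complement borelA
    borel (suc _) = complement borelB

  module _ (P : ProbabilitySpace) where
    open ProbabilitySpace P
    private module Σ-algebra = IsσAlgebra isσAlgebra

    -- The constant sequence of empty sets is disjoint with empty union, so additivity bounds its
    -- second partial sum `p + p` by `p`.
    ℙ-∅ : ℙ (∁ U) ≤ 0ℝ
    ℙ-∅ = +-cancelˡ-≤ p (begin
      p + p         ≡⟨ cong (_+ p) (+-identityˡ p) ⟨
      0ℝ + p + p    ≤⟨ proj₁ (ℙ-additive empty events λ _ _ _ _ (x∉U , _) → x∉U tt) 2 ⟩
      ℙ (⋃ ℕ empty) ≡⟨ ℙ-cong (Σ-algebra.union empty events) event-∅ (proj₂ , λ x∉U → 0 , x∉U) ⟩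
      p             ≡⟨ +-identityʳ p ⟨
      p + 0ℝ        ∎)
      where
      open ≤-Reasoning
      p : ℝ
      p = ℙ (∁ U)
      event-∅ : Event (∁ U)
      event-∅ = Σ-algebra.complement Σ-algebra.whole
      empty : ℕ → Pred Ω 0ℓ
      empty _ = ∁ U
      events : ∀ k → Event (empty k)
      events _ = event-∅

    -- Ensures that the likelier of an event and its complement has probability at least 1/2. Padded
    -- with empty sets, `A` and `∁ A` form a disjoint sequence with union `U`; every partial sum is
    -- at most `ℙ A + ℙ (∁ A)`, hence so is their supremum.
    ℙ-∁ : ∀ {A} → Event A → 1ℝ ≤ ℙ A + ℙ (∁ A)
    ℙ-∁ {A} eventA = begin
      1ℝ            ≡⟨ ℙ-whole ⟨
      ℙ U           ≡⟨ ℙ-cong Σ-algebra.whole (Σ-algebra.union cases events) ((λ {ω} _ → exhaustive ω) , _) ⟩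
      ℙ (⋃ ℕ cases) ≤⟨ proj₂ (ℙ-additive cases events disjoint) _ bound ⟩
      ℙ A + ℙ (∁ A) ∎
      where
      open ≤-Reasoning
      cases : ℕ → Pred Ω 0ℓ
      cases zero          = A
      cases (suc zero)    = ∁ A
      cases (suc (suc _)) = ∁ U
      events : ∀ k → Event (cases k)
      events zero          = eventA
      events (suc zero)    = Σ-algebra.complement eventA
      events (suc (suc _)) = Σ-algebra.complement Σ-algebra.whole
      exhaustive : ∀ ω → ⋃ ℕ cases ω
      exhaustive ω with em {A ω}
      ... | yes ω∈A = 0 , ω∈A
      ... | no  ω∉A = 1 , ω∉A
      disjoint : ∀ j k ω → j ≢ k → ¬ (cases j ω × cases k ω)
      disjoint zero          zero          ω j≢k _           = j≢k refl
      disjoint zero          (suc zero)    ω _   (ω∈A , ω∉A) = ω∉A ω∈A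
      disjoint (suc zero)    zero          ω _   (ω∉A , ω∈A) = ω∉A ω∈A
      disjoint (suc zero)    (suc zero)    ω j≢k _           = j≢k refl
      disjoint (suc (suc _)) _             ω _   (ω∉U , _)   = ω∉U tt
      disjoint _             (suc (suc _)) ω _   (_ , ω∉U)   = ω∉U tt
      bound : ∀ k → partialSum (λ j → ℙ (cases j)) k ≤ ℙ A + ℙ (∁ A)
      bound zero    = +-nonneg (ℙ-nonneg eventA) (ℙ-nonneg (events 1))
      bound (suc zero) = begin
        0ℝ + ℙ A ≡⟨ +-identityˡ (ℙ A) ⟩
        ℙ A      ≤⟨ x≤x+y (ℙ A) (ℙ-nonneg (events 1)) ⟩
        ℙ A + ℙ (∁ A) ∎
      bound (suc (suc zero)) = ≤-reflexive (cong (_+ ℙ (∁ A)) (+-identityˡ (ℙ A)))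
      bound (suc (suc (suc k))) = begin
        partialSum (λ j → ℙ (cases j)) (2 ℕ.+ k) + ℙ (∁ U) ≤⟨ +-mono-≤ (bound (suc (suc k))) ℙ-∅ ⟩
        ℙ A + ℙ (∁ A) + 0ℝ ≡⟨ +-identityʳ _ ⟩
        ℙ A + ℙ (∁ A) ∎

    -- Compares the term that a round adds to the minorant with the cost of that round: off `A` the
    -- term is zero, and nonnegativity of the cost is enough.
    indicator-bound : ∀ {A ω a b} → 0ℝ ≤ b → (A ω → a ≤ b) → a * indicator A ω ≤ b
    indicator-bound {A} {ω} {a} {b} 0≤b a≤b with em {A ω}
    ... | yes ω∈A = subst (_≤ b) (sym (*-identityʳ a)) (a≤b ω∈A)
    ... | no  _   = subst (_≤ b) (sym (zeroʳ a)) 0≤b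

  -- Two costs, one of which is large at every point.

  module _ {n : ℕ} (F : DecisionSpace n) where
    open DecisionSpace F

    -- Distance in a single coordinate is convex, and its sublevel sets are slabs, which are
    -- intersections of two generators of the Borel sets.
    distanceCost : ∀ {W} → 0ℝ < W → Fin n → ℝ → Cost F
    distanceCost {W} 0<W i p = record
      { cost       = λ x → W * ∣ lookup x i - p ∣
      ; nonneg     = λ {x} _ → *-nonneg 0≤W (∣x∣-nonneg (lookup x i - p))
      ; convexCost = λ {x} {y} t 0≤t t≤1 _ _ → convex-bound t (lookup x i) (lookup y i) 0≤t t≤1
                       (trans (lookup-zipWith _+_ i (t • x) ((1ℝ - t) • y))
                              (cong₂ _+_ (lookup-map i _ x) (lookup-map i _ y)))
      -- `V` is the inverse of `W`, so the slab has half-width `V * r` around `p`. For negative `r`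
      -- the slab and the sublevel set are both empty, and no case distinction arises.
      ; measurable = λ r → _ , Borel-∩ (halfspace-≤ i (V * r + p)) (halfspace-≥ i (p - V * r))
                             , λ _ → mk⇔ (inside r) (outside r)
      }
      where
      open ≤-Reasoning
      0≤W : 0ℝ ≤ W
      0≤W = proj₁ 0<W
      V : ℝ
      V = proj₁ (inverse-of-positive 0<W)
      0≤V : 0ℝ ≤ V
      0≤V = proj₁ (proj₂ (inverse-of-positive 0<W))
      WV≡1 : W * V ≡ 1ℝ
      WV≡1 = proj₂ (proj₂ (inverse-of-positive 0<W))
      -- The equation for `z` admits the coordinate of a convex combination of points, which has
      -- this form only propositionally.
      convex-bound : ∀ {z} t x y → 0ℝ ≤ t → t ≤ 1ℝ → z ≡ t * x + (1ℝ - t) * y →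
                     W * ∣ z - p ∣ ≤ t * (W * ∣ x - p ∣) + (1ℝ - t) * (W * ∣ y - p ∣)
      convex-bound t x y 0≤t t≤1 refl = begin
        W * ∣ (t * x + s * y) - p ∣               ≡⟨ cong (λ z → W * ∣ z ∣) (convexCombination-sub t x y p) ⟩
        W * ∣ t * (x - p) + s * (y - p) ∣         ≤⟨ *-monoˡ-≤ 0≤W (∣-∣-convex t (x - p) (y - p) 0≤t t≤1) ⟩
        W * (t * ∣ x - p ∣ + s * ∣ y - p ∣)       ≡⟨ distribˡ W _ _ ⟩
        W * (t * ∣ x - p ∣) + W * (s * ∣ y - p ∣) ≡⟨ cong₂ _+_ (x∙yz≈y∙xz W t _) (x∙yz≈y∙xz W s _) ⟩
        t * (W * ∣ x - p ∣) + s * (W * ∣ y - p ∣) ∎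
        where
        s = 1ℝ - t
      inside : ∀ r {z} → W * ∣ z - p ∣ ≤ r → z ≤ V * r + p × p - V * r ≤ z
      inside r {z} W∣z-p∣≤r =
          x-y≤z⇒x≤z+y (≤-trans (x≤∣x∣ (z - p)) ∣z-p∣≤Vr)
        , x≤y+z⇒x-z≤y (subst (p ≤_) (+-comm (V * r) z)
            (x-y≤z⇒x≤z+y (≤-trans (subst (_≤ ∣ z - p ∣) (-[x-y]≡y-x z p) (-x≤∣x∣ (z - p))) ∣z-p∣≤Vr)))
        where
        ∣z-p∣≤Vr : ∣ z - p ∣ ≤ V * r
        ∣z-p∣≤Vr = begin
          ∣ z - p ∣             ≡⟨ *-identityˡ _ ⟨
          1ℝ * ∣ z - p ∣        ≡⟨ cong (_* ∣ z - p ∣) (trans (*-comm V W) WV≡1) ⟨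
          V * W * ∣ z - p ∣     ≡⟨ *-assoc V W _ ⟩
          V * (W * ∣ z - p ∣)   ≤⟨ *-monoˡ-≤ 0≤V W∣z-p∣≤r ⟩
          V * r                 ∎
      outside : ∀ r {z} → z ≤ V * r + p × p - V * r ≤ z → W * ∣ z - p ∣ ≤ r
      outside r {z} (z≤ , z≥) = begin
        W * ∣ z - p ∣ ≤⟨ *-monoˡ-≤ 0≤W (⊔-lub (x≤y+z⇒x-z≤y z≤) -[z-p]≤Vr) ⟩
        W * (V * r)   ≡⟨ *-assoc W V r ⟨
        W * V * r     ≡⟨ cong (_* r) WV≡1 ⟩
        1ℝ * r        ≡⟨ *-identityˡ r ⟩
        r             ∎
        where
        -[z-p]≤Vr : - (z - p) ≤ V * r
        -[z-p]≤Vr = subst (_≤ V * r) (sym (-[x-y]≡y-x z p))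
          (x≤y+z⇒x-z≤y (subst (p ≤_) (+-comm z (V * r)) (x-y≤z⇒x≤z+y z≥)))

    -- Whatever the law of the next decision, it favours `Region` or its complement, and one of the
    -- two costs charges `w` there. The zeros `u` and `v` are where the dynamic optimum moves, and
    -- `u∉Region` makes the costs distinct.
    record CostPair (w : ℝ) (u v : ∃ Feasible) : Set₁ where
      field
        f g         : Cost F
        f-zero      : cost f (proj₁ u) ≡ 0ℝ
        g-zero      : cost g (proj₁ v) ≡ 0ℝ
        Region      : Pred (Point n) 0ℓ
        Region-borel : Borel Region
        f-expensive : ∀ {x} → Region x → w ≤ cost f x
        g-expensive : ∀ {x} → ¬ Region x → w ≤ cost g x
        u∉Region    : ¬ Region (proj₁ u)

    costPair-distinct : ∀ {w u v} → 0ℝ < w → (𝒫 : CostPair w u v) →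
                        Distinct (CostPair.f 𝒫) (CostPair.g 𝒫)
    costPair-distinct {w} {u} (0≤w , 0≢w) 𝒫 = proj₁ u , proj₂ u , λ fu≡gu →
      0≢w (antisym 0≤w (subst (w ≤_) (trans (sym fu≡gu) f-zero) (g-expensive u∉Region)))
      where open CostPair 𝒫

    -- `Region` is the half-space beyond the midpoint `a + δ` of the coordinates `a` and `b`. Every
    -- point lies at distance at least `δ` from `a` or from `b` in that coordinate, and the slope
    -- `W` is `w` divided by `δ`.
    costPair : ∀ {w} → 0ℝ < w → (u v : ∃ Feasible) → ∀ i →
               lookup (proj₁ u) i < lookup (proj₁ v) i → CostPair w u v
    costPair {w} (0≤w , 0≢w) u v i (a≤b , a≢b) = record
      { f            = distanceCost 0<W i a
      ; g            = distanceCost 0<W i b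
      ; f-zero       = trans (cong (W *_) (∣x-x∣≡0 a)) (zeroʳ W)
      ; g-zero       = trans (cong (W *_) (∣x-x∣≡0 b)) (zeroʳ W)
      ; Region       = λ x → a + δ ≤ lookup x i
      ; Region-borel = halfspace-≥ i (a + δ)
      ; f-expensive  = λ a+δ≤x → expensive
          (≤-trans (x+y≤z⇒x≤z-y (subst (_≤ _) (+-comm a δ) a+δ≤x)) (x≤∣x∣ _))
      ; g-expensive  = λ {x} a+δ≰x → expensive (begin
          δ               ≤⟨ x+y≤z⇒x≤z-y (begin
                               δ + lookup x i ≤⟨ +-monoʳ-≤ δ (≰⇒≥ a+δ≰x) ⟩
                               δ + (a + δ)    ≡⟨ +-comm δ (a + δ) ⟩
                               a + δ + δ      ≡⟨ a+δ+δ≡b ⟩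
                               b              ∎) ⟩
          b - lookup x i  ≡⟨ -[x-y]≡y-x (lookup x i) b ⟨
          - (lookup x i - b) ≤⟨ -x≤∣x∣ _ ⟩
          ∣ lookup x i - b ∣ ∎)
      ; u∉Region     = λ a+δ≤a → proj₂ 0<δ (antisym (proj₁ 0<δ) (+-cancelˡ-≤ a
                         (subst (a + δ ≤_) (sym (+-identityʳ a)) a+δ≤a)))
      }
      where
      open ≤-Reasoning
      a b : ℝ
      a = lookup (proj₁ u) i
      b = lookup (proj₁ v) i
      0<b-a : 0ℝ < b - a
      0<b-a = x≤y⇒0≤y-x a≤b , λ 0≡b-a →
        a≢b (trans (sym (+-identityˡ a)) (trans (cong (_+ a) 0≡b-a) (x-y+y≡x a b)))
      δ : ℝ
      δ = proj₁ (half-of-positive 0<b-a)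
      0<δ : 0ℝ < δ
      0<δ = proj₁ (proj₂ (half-of-positive 0<b-a))
      a+δ+δ≡b : a + δ + δ ≡ b
      a+δ+δ≡b = trans (+-assoc a δ δ) (trans (cong (a +_) (proj₂ (proj₂ (half-of-positive 0<b-a))))
                  (trans (+-comm a (b - a)) (x-y+y≡x a b)))
      V W : ℝ
      V = proj₁ (inverse-of-positive 0<δ)
      W = w * V
      Wδ≡w : W * δ ≡ w
      Wδ≡w = trans (*-assoc w V δ) (trans (cong (w *_) (trans (*-comm V δ)
               (proj₂ (proj₂ (inverse-of-positive 0<δ))))) (*-identityʳ w))
      0<W : 0ℝ < W
      0<W = *-nonneg 0≤w (proj₁ (proj₂ (inverse-of-positive 0<δ))) , λ 0≡W →
        0≢w (trans (sym (zeroˡ δ)) (trans (cong (_* δ) 0≡W) Wδ≡w))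
      expensive : ∀ {z} → δ ≤ z → w ≤ W * z
      expensive {z} δ≤z = subst (_≤ W * z) Wδ≡w (*-monoˡ-≤ (proj₁ 0<W) δ≤z)

    -- Two distinct points differ in some coordinate; the one with the smaller value there is taken
    -- as `u`.
    separatingCoordinate : Nontrivial F →
      ∃₂ λ (u v : ∃ Feasible) → ∃ λ i → lookup (proj₁ u) i < lookup (proj₁ v) i
    separatingCoordinate (x , y , x∈F , y∈F , x≢y) with differ x y x≢y
      where
      differ : ∀ {m} (x y : Point m) → x ≢ y → ∃ λ i → lookup x i ≢ lookup y i
      differ []      []      x≢y = ⊥-elim (x≢y refl)
      differ (a ∷ x) (b ∷ y) x≢y with em {a ≡ b}
      ... | no  a≢b  = zero , a≢b
      ... | yes refl = let i , xᵢ≢yᵢ = differ x y (λ x≡y → x≢y (cong (a ∷_) x≡y)) in suc i , xᵢ≢yᵢ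
    ... | i , xᵢ≢yᵢ with total (lookup x i) (lookup y i)
    ...   | inj₁ xᵢ≤yᵢ = (x , x∈F) , (y , y∈F) , i , xᵢ≤yᵢ , xᵢ≢yᵢ
    ...   | inj₂ yᵢ≤xᵢ = (y , y∈F) , (x , x∈F) , i , yᵢ≤xᵢ , λ yᵢ≡xᵢ → xᵢ≢yᵢ (sym yᵢ≡xᵢ)

  -- Uniform bound on the steps of the dynamic optimum.

  module Steps {n} (ν : Seminorm n) (u v : Point n) where
    open Seminorm ν using (‖_‖) renaming (nonneg to ‖‖-nonneg)

    stepsFrom : Point n → ℝ
    stepsFrom x = ‖ u ⊖ x ‖ + ‖ v ⊖ x ‖

    stepsFrom-nonneg : ∀ x → 0ℝ ≤ stepsFrom x
    stepsFrom-nonneg x = +-nonneg (‖‖-nonneg (u ⊖ x)) (‖‖-nonneg (v ⊖ x))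

    -- A sum in place of a maximum, since nonnegative summands already make it dominate each of
    -- them. The steps from `u` to `u` and from `v` to `v` are included, so staying in place is no
    -- special case.
    D : ℝ
    D = stepsFrom origin + (stepsFrom u + stepsFrom v)

    D-nonneg : 0ℝ ≤ D
    D-nonneg = +-nonneg (stepsFrom-nonneg origin)
                        (+-nonneg (stepsFrom-nonneg u) (stepsFrom-nonneg v))

    origin≤D : stepsFrom origin ≤ D
    origin≤D = x≤x+y _ (+-nonneg (stepsFrom-nonneg u) (stepsFrom-nonneg v))

    u≤D : stepsFrom u ≤ D
    u≤D = ≤-trans (x≤x+y _ (stepsFrom-nonneg v)) (y≤x+y _ (stepsFrom-nonneg origin))

    v≤D : stepsFrom v ≤ D
    v≤D = ≤-trans (y≤x+y _ (stepsFrom-nonneg u)) (y≤x+y _ (stepsFrom-nonneg origin))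

  -- The adversarial sequence and the resulting bounds.

  module Adversary {n} {F : DecisionSpace n} (ν : Seminorm n) {α} (1≤α : 1ℝ ≤ α) (A : Algorithm F)
                   {u v : ∃ (DecisionSpace.Feasible F)}
                   {q} (0≤q : 0ℝ ≤ q) (𝒫 : CostPair F (q + q) u v) where
    open DecisionSpace F
    open Seminorm ν using (‖_‖) renaming (nonneg to ‖‖-nonneg)
    open Algorithm A
    open CostPair 𝒫
    open Steps ν (proj₁ u) (proj₁ v)
    open ≤-Reasoning

    𝕮 : Pred (Cost F) (lsuc 0ℓ)
    𝕮 = ｛ f ｝ ∪ ｛ g ｝

    0≤α : 0ℝ ≤ α
    0≤α = ≤-trans 0≤1 1≤α

    -- The costs that the adversary presents after the history h, with moves from x₀
    -- of the dynamic optimum and a simple function below the cost of A.  The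
    -- latter must not depend on the unknown last decision x₁ of A.
    record Instance (h : List (Cost F)) (x₀ : Point n) (T : ℕ) : Set₁ where
      field
        costs          : Vec (Cost F) T
        costs∈𝕮        : VecAll.All 𝕮 costs
        moves          : Vec (∃ Feasible) T
        moves-cheap    : penalizedCostFrom ν α x₀ costs (Vec.map proj₁ moves) ≤ fromℕ T * (α * D)
        minorant       : Simple
        minorant-below : ∀ x₁ ω → Simple.value minorant ω ≤
                         penalizedCostFrom ν 1ℝ x₁ costs (playAfter h costs ω)
        integral-large : fromℕ T * q ≤ Simple.integral minorant

    -- Prepends one round. The optimum moves to the zero `y` of `c`, while the minorant gains the
    -- value `q + q` on the event that the decision falls in `S`; as `likely` gives this event
    -- probability at least 1/2, the integral grows by at least `q`.
    extend : ∀ {h x₀ T c} → 𝕮 c → (y : ∃ Feasible) → cost c (proj₁ y) ≡ 0ℝ → ‖ proj₁ y ⊖ x₀ ‖ ≤ D →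
             ∀ {S} → Borel S → (∀ {x} → S x → q + q ≤ cost c x) →
             1ℝ ≤ ℙ (decide h ⊢ S) + ℙ (decide h ⊢ S) →
             Instance (h ∷ʳ c) (proj₁ y) T → Instance h x₀ (suc T)
    extend {h} {x₀} {T} {c} c∈𝕮 y cy≡0 step≤D {S} borelS expensive likely I = record
      { costs          = c ∷ costs
      ; costs∈𝕮        = c∈𝕮 ∷ costs∈𝕮
      ; moves          = y ∷ moves
      ; moves-cheap    = begin
          (cost c (proj₁ y) + α * ‖ proj₁ y ⊖ x₀ ‖) + rest
            ≡⟨ cong (λ z → (z + α * ‖ proj₁ y ⊖ x₀ ‖) + rest) cy≡0 ⟩
          (0ℝ + α * ‖ proj₁ y ⊖ x₀ ‖) + rest
            ≡⟨ cong (_+ rest) (+-identityˡ _) ⟩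
          α * ‖ proj₁ y ⊖ x₀ ‖ + rest
            ≤⟨ +-mono-≤ (*-monoˡ-≤ 0≤α step≤D) moves-cheap ⟩
          α * D + fromℕ T * (α * D)
            ≡⟨ suc-*-≡ T (α * D) ⟨
          fromℕ (suc T) * (α * D) ∎
      ; minorant       = record
          { terms        = (q + q , decide h ⊢ S) ∷ Simple.terms minorant
          ; coeff-nonneg = +-nonneg 0≤q 0≤q ∷ Simple.coeff-nonneg minorant
          ; measurable   = measurable h borelS ∷ Simple.measurable minorant
          }
      ; minorant-below = λ x₁ ω → +-mono-≤
          -- The movement cost of `A` in this round is bounded below by zero.
          (≤-trans (indicator-bound space {A = decide h ⊢ S} (Cost.nonneg c (feasible h ω)) expensive)
                   (x≤x+y _ (*-nonneg 0≤1 (‖‖-nonneg (decide h ω ⊖ x₁)))))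
          -- The bound for the later rounds holds for every previous decision, so it applies to the
          -- random point `decide h ω`.
          (minorant-below (decide h ω) ω)
      ; integral-large = begin
          fromℕ (suc T) * q ≡⟨ suc-*-≡ T q ⟩
          q + fromℕ T * q   ≤⟨ +-mono-≤ q≤2qp integral-large ⟩
          (q + q) * p + Simple.integral minorant ∎
      }
      where
      open Instance I
      rest p : ℝ
      rest = penalizedCostFrom ν α (proj₁ y) costs (Vec.map proj₁ moves)
      p = ℙ (decide h ⊢ S)
      q≤2qp : q ≤ (q + q) * p
      q≤2qp = begin
        q             ≡⟨ *-identityʳ q ⟨
        q * 1ℝ        ≤⟨ *-monoˡ-≤ 0≤q likely ⟩
        q * (p + p)   ≡⟨ distribˡ q p p ⟩
        q * p + q * p ≡⟨ distribʳ p q q ⟨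
        (q + q) * p   ∎

    -- Recursion forward in time: the law of `decide h` is fixed by the costs already shown, so each
    -- choice depends on `h` but not on `ω`, and one sequence serves all outcomes. The bound on
    -- `stepsFrom x₀` is the invariant that keeps the next move of the optimum within `D`.
    adversary : ∀ T h x₀ → stepsFrom x₀ ≤ D → Instance h x₀ T
    adversary zero h x₀ _ = record
      { costs          = []
      ; costs∈𝕮        = []
      ; moves          = []
      ; moves-cheap    = ≤-reflexive (sym (zeroˡ (α * D)))
      ; minorant       = record { terms = [] ; coeff-nonneg = [] ; measurable = [] }
      ; minorant-below = λ _ _ → ≤-refl
      ; integral-large = ≤-reflexive (zeroˡ q)
      }
    adversary (suc T) h x₀ x₀≤D
      -- The cost shown is the one that is expensive on the likelier side.
      with total (ℙ (decide h ⊢ ∁ Region)) (ℙ (decide h ⊢ Region))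
         | ℙ-∁ space (measurable h Region-borel)
    ... | inj₁ ∁≤ | 1≤ = extend (inj₁ refl) u f-zero (≤-trans (x≤x+y _ (‖‖-nonneg _)) x₀≤D)
                           Region-borel f-expensive (≤-trans 1≤ (+-monoʳ-≤ _ ∁≤))
                           (adversary T (h ∷ʳ f) (proj₁ u) u≤D)
    ... | inj₂ ≤∁ | 1≤ = extend (inj₂ refl) v g-zero (≤-trans (y≤x+y _ (‖‖-nonneg _)) x₀≤D)
                           (complement Region-borel) g-expensive (≤-trans 1≤ (+-monoˡ-≤ _ ≤∁))
                           (adversary T (h ∷ʳ g) (proj₁ v) v≤D)

    module Horizon (T : ℕ) where
      open Instance (adversary T [] origin origin≤D) public

      OPT : ℝ
      OPT = OPT_d ν α 1≤α costs

      OPT-nonneg : 0ℝ ≤ OPT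
      OPT-nonneg = inf-nonneg {I = Vec (∃ Feasible) T}
        (λ xs → penalizedCost ν α costs (Vec.map proj₁ xs)) _ _

      OPT≤ : OPT ≤ fromℕ T * (α * D)
      OPT≤ = ≤-trans (inf-lower {I = Vec (∃ Feasible) T}
        (λ xs → penalizedCost ν α costs (Vec.map proj₁ xs)) _ _ moves) moves-cheap

      -- A bound on the expectation is by definition a bound on the integral of every simple
      -- function below the cost, in particular of the minorant.
      expectedCost-large : ∀ {r} → ExpectedCost≤ ν A 1ℝ costs r → fromℕ T * q ≤ r
      expectedCost-large bound = ≤-trans integral-large (bound minorant (minorant-below origin))

    -- Per round the algorithm pays at least `q` on average and the optimum at most `α * D`; the gap
    -- is at least `γ`.
    competitiveDifference-large : ∀ {γ} → α * D + γ ≤ q → ∀ T →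
      Best CompetitiveDifference≤ ν A 𝕮 T α 1≤α ≥ γ * fromℕ T
    competitiveDifference-large {γ} αD+γ≤q T ρ bound = +-cancelˡ-≤ (fromℕ T * (α * D)) (begin
      fromℕ T * (α * D) + γ * fromℕ T   ≡⟨ cong (fromℕ T * (α * D) +_) (*-comm γ (fromℕ T)) ⟩
      fromℕ T * (α * D) + fromℕ T * γ   ≡⟨ distribˡ (fromℕ T) (α * D) γ ⟨
      fromℕ T * (α * D + γ)             ≤⟨ *-monoˡ-≤ (fromℕ-nonneg T) αD+γ≤q ⟩
      fromℕ T * q                       ≤⟨ expectedCost-large (bound costs costs∈𝕮) ⟩
      OPT + ρ                           ≤⟨ +-monoˡ-≤ ρ OPT≤ ⟩
      fromℕ T * (α * D) + ρ             ∎)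
      where open Horizon T

    -- A ratio `ρ` at most `γ` would leave a surplus of at least 1 per round to be covered by `K`,
    -- forcing `fromℕ T ≤ K`.
    competitiveRatio-large : ∀ {γ} → 0ℝ ≤ γ → γ * (α * D) + 1ℝ ≤ q → ∀ K T → ¬ (fromℕ T ≤ K) →
      Best CompetitiveRatio≤ ν A 𝕮 T α 1≤α K ≥ γ
    competitiveRatio-large {γ} 0≤γ γαD+1≤q K T T≰K ρ bound with total γ ρ
    ... | inj₁ γ≤ρ = γ≤ρ
    ... | inj₂ ρ≤γ = ⊥-elim (T≰K (+-cancelˡ-≤ (t * (γ * (α * D))) (begin
      t * (γ * (α * D)) + t        ≡⟨ cong (t * (γ * (α * D)) +_) (*-identityʳ t) ⟨
      t * (γ * (α * D)) + t * 1ℝ   ≡⟨ distribˡ t (γ * (α * D)) 1ℝ ⟨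
      t * (γ * (α * D) + 1ℝ)       ≤⟨ *-monoˡ-≤ (fromℕ-nonneg T) γαD+1≤q ⟩
      t * q                        ≤⟨ expectedCost-large (bound costs costs∈𝕮) ⟩
      -- As `ρ` may be negative, it is replaced by `γ` before `OPT` is bounded from above.
      ρ * OPT + K                  ≤⟨ +-monoˡ-≤ K (*-monoʳ-≤ OPT-nonneg ρ≤γ) ⟩
      γ * OPT + K                  ≤⟨ +-monoˡ-≤ K (*-monoˡ-≤ 0≤γ OPT≤) ⟩
      γ * (t * (α * D)) + K        ≡⟨ cong (_+ K) (x∙yz≈y∙xz γ t (α * D)) ⟩
      t * (γ * (α * D)) + K        ∎)))
      where
      open Horizon T
      t : ℝ
      t = fromℕ T

-- Choice of the constants and conclusion.

theorem2 : (em : ExcludedMiddle 0ℓ) (ℛ : RealNumbers) → let open SOCO em ℛ in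
    (n : ℕ) (ν : Seminorm n) (F : DecisionSpace n) → Nontrivial F →
    (γ α : ℝ) → 0ℝ < γ → (1≤α : 1ℝ ≤ α) → (A : Algorithm F) →
    ∃₂ λ (f g : Cost F) → Distinct f g ×
    ( let 𝕮 = ｛ f ｝ ∪ ｛ g ｝ in
    BestIsΩ[T] (Regret≤ ν A 𝕮)
    ⊎
    ((K : ℝ) → Eventually λ T →
    Best CompetitiveRatio≤ ν A 𝕮 T α 1≤α K ≥ γ
    × Best CompetitiveDifference≤ ν A 𝕮 T α 1≤α ≥ γ * fromℕ T) )
theorem2 em ℛ n ν F nontrivial γ α (0≤γ , 0≢γ) 1≤α A =
  f , g , costPair-distinct F 0<2q pair , inj₂ λ K →
    -- Only the threshold `N` depends on `K`; the costs `f` and `g` are fixed beforehand.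
    let N , N≰K = archimedean em K in
    N , λ T N≤T →
        competitiveRatio-large 0≤γ (y≤x+y _ 0≤αD+γ) K T
          (λ T≤K → N≰K (≤-trans (fromℕ-mono-≤ N≤T) T≤K))
      , competitiveDifference-large (x≤x+y _ 0≤γαD+1) T
  where
  open SOCO em ℛ
  open OrderedField ℛ
  open LowerBound em ℛ
  open DecisionSpace F using (Feasible)

  separation : ∃₂ λ (u v : ∃ Feasible) → ∃ λ i → lookup (proj₁ u) i < lookup (proj₁ v) i
  separation = separatingCoordinate F nontrivial

  u v : ∃ Feasible
  u = proj₁ separation
  v = proj₁ (proj₂ separation)

  open Steps ν (proj₁ u) (proj₁ v) using (D; D-nonneg)

  0≤αD : 0ℝ ≤ α * D
  0≤αD = *-nonneg (≤-trans 0≤1 1≤α) D-nonneg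

  0≤αD+γ : 0ℝ ≤ α * D + γ
  0≤αD+γ = +-nonneg 0≤αD 0≤γ

  0≤γαD+1 : 0ℝ ≤ γ * (α * D) + 1ℝ
  0≤γαD+1 = +-nonneg (*-nonneg 0≤γ 0≤αD) 0≤1

  q : ℝ
  -- The first summand serves the competitive difference, the second the competitive ratio; both are
  -- nonnegative, so `q` dominates each.
  q = (α * D + γ) + (γ * (α * D) + 1ℝ)

  γ≤q : γ ≤ q
  γ≤q = ≤-trans (y≤x+y γ 0≤αD) (x≤x+y _ 0≤γαD+1)

  0≤q : 0ℝ ≤ q
  0≤q = ≤-trans 0≤γ γ≤q

  0<2q : 0ℝ < q + q
  0<2q = +-nonneg 0≤q 0≤q , λ 0≡2q →
    0≢γ (antisym 0≤γ (≤-trans γ≤q (subst (q ≤_) (sym 0≡2q) (x≤x+y q 0≤q))))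

  pair : CostPair F (q + q) u v
  pair = costPair F 0<2q u v (proj₁ (proj₂ (proj₂ separation))) (proj₂ (proj₂ (proj₂ separation)))

  open CostPair pair using (f; g)
  open Adversary ν 1≤α A 0≤q pair using (competitiveRatio-large; competitiveDifference-large)
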